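{- Cartesian products, finite or infinite, of Ramsey algebras need not be Ramsey. That is: (i) there exists a finite family of infinite Ramsey algebras of a common language whose Cartesian product is not a Ramsey algebra; and (ii) there exists an infinite family of infinite Ramsey algebras of a common language whose Cartesian product is not a Ramsey algebra.
   Context: An algebra $\mathcal{A}=(A,\mathcal{F})$ consists of a set $A$ and a family $\mathcal{F}$ of finitary operations $f:A^n\to A$ on $A$; it is infinite if $A$ is infinite. When $\mathcal{L}$ is a set of function symbols (a purely functional language), an algebra of the language $\mathcal{L}$ is an $\mathcal{L}$-structure, $\mathcal{F}$ being the family of interpretations of the symbols. The Cartesian product of a family of algebras of the same language $\mathcal{L}$ has as universe the Cartesian product of the universes, and each function symbol is interpreted coordinatewise. An $n$-ary $f$ is an orderly composition of a family $\mathcal{G}$ of operations if there are a $k$-ary $g\in\mathcal{G}$ and $n_j$-ary $h_j\in\mathcal{G}$ ($1\le j\le k$) with $\sum_{j=1}^k n_j=n$ such that $f(x_1,\dots,x_n)=g(h_1(\bar x_1),\dots,h_k(\bar x_k))$, where $\bar x_1,\dots,\bar x_k$ are the consecutive blocks of $(x_1,\dots,x_n)$ of lengths $n_1,\dots,n_k$. The set $\mathrm{OT}(\mathcal{F})$ of orderly terms over $\mathcal{F}$ is the smallest collection of operations on $A$ that contains $\mathcal{F}\cup\{\mathrm{id}_A\}$ and is closed under orderly composition. For infinite sequences $\vec a,\vec b\in{}^\omega A$, $\vec a$ is a reduction of $\vec b$, written $\vec a\le_{\mathcal{F}}\vec b$, if there are orderly terms $f_j\in\mathrm{OT}(\mathcal{F})$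 and finite subsequences $\vec b_j$ of $\vec b$ ($j\in\omega$) such that $\vec a(j)=f_j(\vec b_j)$ for every $j$ and the concatenation $\vec b_0*\vec b_1*\cdots$ is a subsequence of $\vec b$. Put $\mathrm{FR}_{\mathcal{F}}(\vec b)=\{\vec a(0):\vec a\le_{\mathcal{F}}\vec b\}$. The algebra $(A,\mathcal{F})$ is a Ramsey algebra if for every $\vec b\in{}^\omega A$ and every $X\subseteq A$ there is $\vec a\le_{\mathcal{F}}\vec b$ such that $\mathrm{FR}_{\mathcal{F}}(\vec a)$ is either contained in $X$ or disjoint from $X$. -}

module Defs where

open import Data.Fin as Fin using (Fin)
open import Data.Nat using (ℕ; _<_)
open import Data.Product using (∃; _×_)
open import Data.Sum using (_⊎_)
open import Data.Vec using (Vec; []; _∷_; head; take; drop; map; lookup; tabulate; sum)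
open import Function using (_∘_; _↔_)
open import Level using (0ℓ)
open import Relation.Binary.PropositionalEquality using (_≡_)
open import Relation.Nullary using (¬_)
open import Relation.Unary using (Pred; _⊆_; _⊥_)

Infinite : Set → Set
Infinite A = ¬ (∃ λ n → A ↔ Fin n)

Op : Set → ℕ → Set
Op A n = Vec A n → A

record Language : Set₁ where
  field
    Symbol : Set
    arity  : Symbol → ℕ

open Language public

record Algebra (L : Language) : Set₁ where
  field
    Carrier : Set
    interp  : (s : Symbol L) → Op Carrier (arity L s)

open Algebra public

∏ : ∀ {L} {I : Set} → (I → Algebra L) → Algebra L
∏ {I = I} 𝒜 = record
  { Carrier = (i : I) → Carrier (𝒜 i)
  ; interp  = λ s xs i → interp (𝒜 i) s (map (λ x → x i) xs)
  }

-- Cuts the argument tuple into consecutive blocks of lengths ns and applies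
-- the j-th operation to the j-th block.
blockwise : ∀ {A k} (ns : Vec ℕ k) → (∀ j → Op A (lookup ns j)) →
            Vec A (sum ns) → Vec A k
blockwise []       h xs = []
blockwise (n ∷ ns) h xs =
  h Fin.zero (take n xs) ∷ blockwise ns (h ∘ Fin.suc) (drop n xs)

orderlyComposition : ∀ {A k} → Op A k → (ns : Vec ℕ k) →
                     (∀ j → Op A (lookup ns j)) → Op A (sum ns)
orderlyComposition g ns h xs = g (blockwise ns h xs)

data OT {L} (𝒜 : Algebra L) : ∀ {n} → Op (Carrier 𝒜) n → Set where
  basic    : ∀ s → OT 𝒜 (interp 𝒜 s)
  identity : OT 𝒜 {1} head
  compose  : ∀ {k} {g : Op (Carrier 𝒜) k} (ns : Vec ℕ k)
             {h : ∀ j → Op (Carrier 𝒜) (lookup ns j)} →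
             OT 𝒜 g → (∀ j → OT 𝒜 (h j)) →
             OT 𝒜 (orderlyComposition g ns h)

-- The j-th finite subsequence of b is given by the positions
-- pos j 0 < pos j 1 < ⋯ of its entries in b.  The fields within and across say
-- together that pos is strictly increasing for the lexicographic order on
-- pairs (j , p), i.e. that the concatenation of all these finite sequences is a
-- subsequence of b.
record Reduction {L} (𝒜 : Algebra L) (a b : ℕ → Carrier 𝒜) : Set where
  field
    length  : ℕ → ℕ
    term    : ∀ j → Op (Carrier 𝒜) (length j)
    orderly : ∀ j → OT 𝒜 (term j)
    pos     : ∀ j → Fin (length j) → ℕ
    within  : ∀ j p q → p Fin.< q → pos j p < pos j q
    across  : ∀ i j → i < j → ∀ p q → pos i p < pos j q
    value   : ∀ j → a j ≡ term j (tabulate (b ∘ pos j))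

FR : ∀ {L} (𝒜 : Algebra L) → (ℕ → Carrier 𝒜) → Pred (Carrier 𝒜) 0ℓ
FR 𝒜 b x = ∃ λ a → Reduction 𝒜 a b × a 0 ≡ x

Ramsey : ∀ {L} → Algebra L → Set₁
Ramsey 𝒜 = (b : ℕ → Carrier 𝒜) (X : Pred (Carrier 𝒜) 0ℓ) →
  ∃ λ a → Reduction 𝒜 a b × (FR 𝒜 a ⊆ X ⊎ FR 𝒜 a ⊥ X)

{-# OPTIONS --safe #-}

-- If every operation is a projection, FR(b) is just the set of entries of b, so
-- the algebra is Ramsey by the pigeonhole principle.  Let one factor interpret
-- the binary symbols f, g as first and second projection, and another one as
-- second and first projection.  For the diagonal sequence b(n) = (n, n, …) and
-- a reduction a of it, every coordinate of a(0) lies below every coordinate of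
-- a(1), whence f(a(0), a(1)) and g(a(0), a(1)) are separated by the set of points
-- whose coordinate in the first of these factors is less than that in the other.
module Submission where

open import Defs
open import Axiom.ExcludedMiddle using (ExcludedMiddle)
open import Data.Bool using (Bool; true; false; if_then_else_; _xor_)
open import Data.Fin as Fin using (Fin; toℕ)
open import Data.Fin.Properties using (toℕ<n; ℕ→Fin-notInjective)
open import Data.Nat using (ℕ; zero; suc; _+_; _*_; _≤_; _<_; s≤s)
open import Data.Nat.Properties
open import Data.Product using (Σ-syntax; ∃; _×_; _,_; proj₁; proj₂)
open import Data.Sum using (_⊎_; inj₁; inj₂)
open import Data.Vec using (Vec; []; _∷_; head; lookup; tabulate)
open import Data.Vec.Relation.Unary.All using (All; []; _∷_)
open import Data.Vec.Relation.Unary.All.Properties using (take⁺; drop⁺; tabulate⁺)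
open import Function using (_∘_)
open import Function.Bundles using (Injection)
open import Function.Properties.Inverse using (↔⇒↣)
open import Level using (0ℓ)
open import Relation.Binary.PropositionalEquality using (_≡_; refl; sym; subst; subst₂)
open import Relation.Nullary using (¬_; yes; no)
open import Relation.Nullary.Decidable using (decidable-stable)
open import Relation.Unary using (Pred; _⊆_; _⊥_; ∁)

ℕ-infinite : Infinite ℕ
ℕ-infinite (_ , ℕ↔Fin) =
  ℕ→Fin-notInjective (Injection.to ℕ↣Fin) (Injection.injective ℕ↣Fin)
  where ℕ↣Fin = ↔⇒↣ ℕ↔Fin

StrictlyIncreasing : (ℕ → ℕ) → Set
StrictlyIncreasing g = ∀ {i j} → i < j → g i < g j

step⇒strictlyIncreasing : ∀ g → (∀ n → g n < g (suc n)) → StrictlyIncreasing g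
step⇒strictlyIncreasing g step {i} {suc j} (s≤s i≤j) with m≤n⇒m<n∨m≡n i≤j
... | inj₁ i<j  = <-trans (step⇒strictlyIncreasing g step i<j) (step j)
... | inj₂ refl = step i

unbounded⇒enumeration : ∀ {P : Pred ℕ 0ℓ} → (∀ N → ∃ λ n → N ≤ n × P n) →
                        ∃ λ g → StrictlyIncreasing g × (∀ n → P (g n))
unbounded⇒enumeration {P} next =
  g , step⇒strictlyIncreasing g (λ n → proj₁ (proj₂ (next (suc (g n))))) , P-g
  where
  g : ℕ → ℕ
  g zero    = proj₁ (next 0)
  -- The search resumes at `suc (g n)`, not at `g n`, so that `g` increases strictly.
  g (suc n) = proj₁ (next (suc (g n)))

  P-g : ∀ n → P (g n)
  P-g zero    = proj₂ (proj₂ (next 0))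
  P-g (suc n) = proj₂ (proj₂ (next (suc (g n))))

-- Either `P` fails from some `N` on, and the shift by `N` serves, or `P` holds arbitrarily far out
-- and its instances can be enumerated.
pigeonhole-ω : ExcludedMiddle 0ℓ → (P : Pred ℕ 0ℓ) →
               ∃ λ g → StrictlyIncreasing g × ((∀ n → P (g n)) ⊎ (∀ n → ¬ P (g n)))
pigeonhole-ω em P with em {∃ λ N → ∀ n → N ≤ n → ¬ P n}
... | yes (N , ¬P) =
  (N +_) , +-monoʳ-< N , inj₂ (λ n → ¬P (N + n) (m≤m+n N n))
... | no ¬bounded =
  let g , inc , P-g = unbounded⇒enumeration next in g , inc , inj₁ P-g
  where
  next : ∀ N → ∃ λ n → N ≤ n × P n
  next N = decidable-stable em λ none →
    ¬bounded (N , λ n N≤n Pn → none (n , N≤n , Pn))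

ClosedUnder : ∀ {A : Set} {n} → Pred A 0ℓ → Op A n → Set
ClosedUnder Q f = ∀ {xs} → All Q xs → Q (f xs)

module _ {L : Language} {𝒜 : Algebra L} where

  blockwise-All : ∀ {Q : Pred (Carrier 𝒜) 0ℓ} {k} (ns : Vec ℕ k)
                  {h : ∀ j → Op (Carrier 𝒜) (lookup ns j)} →
                  (∀ j → ClosedUnder Q (h j)) →
                  ∀ {xs} → All Q xs → All Q (blockwise ns h xs)
  blockwise-All []       closed qs = []
  blockwise-All (n ∷ ns) closed qs =
    closed Fin.zero (take⁺ n qs) ∷
    blockwise-All ns (λ j → closed (Fin.suc j)) (drop⁺ n qs)

  -- Induction on the orderly term: each block inherits `Q` from the whole tuple, so the inner
  -- values satisfy `Q`, and then so does the outer one.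
  OT-closed : ∀ {Q : Pred (Carrier 𝒜) 0ℓ} → (∀ s → ClosedUnder Q (interp 𝒜 s)) →
              ∀ {n} {t : Op (Carrier 𝒜) n} → OT 𝒜 t → ClosedUnder Q t
  OT-closed closed (basic s) qs             = closed s qs
  OT-closed closed identity (q ∷ _)         = q
  OT-closed closed (compose ns ot-g ot-h) qs =
    OT-closed closed ot-g (blockwise-All ns (λ j → OT-closed closed (ot-h j)) qs)

  -- `Q` is required only at the positions used for `a j`, so it may be chosen to depend on `j`.
  reduction-closed : ∀ {Q : Pred (Carrier 𝒜) 0ℓ} → (∀ s → ClosedUnder Q (interp 𝒜 s)) →
                     ∀ {a b} (r : Reduction 𝒜 a b) j →
                     (∀ p → Q (b (Reduction.pos r j p))) → Q (a j)
  reduction-closed {Q} closed r j qs =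
    subst Q (sym (value j)) (OT-closed closed (orderly j) (tabulate⁺ qs))
    where open Reduction r

  FR-closed : ∀ {Q : Pred (Carrier 𝒜) 0ℓ} → (∀ s → ClosedUnder Q (interp 𝒜 s)) →
              ∀ {b} → (∀ n → Q (b n)) → FR 𝒜 b ⊆ Q
  FR-closed closed qs (_ , r , refl) =
    reduction-closed closed r 0 (λ p → qs (Reduction.pos r 0 p))

  subsequence : ∀ {g} → StrictlyIncreasing g → ∀ b → Reduction 𝒜 (b ∘ g) b
  subsequence {g} inc b = record
    { length  = λ _ → 1
    ; term    = λ _ → head
    ; orderly = λ _ → identity
    ; pos     = λ j _ → g j
    ; within  = λ { _ Fin.zero Fin.zero () }
    ; across  = λ _ _ i<j _ _ → inc i<j
    ; value   = λ _ → refl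
    }

  -- The witness applies t to consecutive blocks of length n.
  initial∈FR : ∀ {n} {t : Op (Carrier 𝒜) n} → OT 𝒜 t →
               ∀ b → FR 𝒜 b (t (tabulate (b ∘ toℕ)))
  initial∈FR {n} {t} ot b = _ , reduction , refl
    where
    reduction : Reduction 𝒜 (λ j → t (tabulate (λ p → b (j * n + toℕ p)))) b
    reduction = record
      { length  = λ _ → n
      ; term    = λ _ → t
      ; orderly = λ _ → ot
      ; pos     = λ j p → j * n + toℕ p
      ; within  = λ j _ _ → +-monoʳ-< (j * n)
      ; across  = λ i j i<j p q → begin-strict
          i * n + toℕ p  <⟨ +-monoʳ-< (i * n) (toℕ<n p) ⟩
          i * n + n      ≡⟨ +-comm (i * n) n ⟩
          suc i * n      ≤⟨ *-monoˡ-≤ n i<j ⟩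
          j * n          ≤⟨ m≤m+n (j * n) (toℕ q) ⟩
          j * n + toℕ q  ∎
      ; value   = λ _ → refl
      }
      where open ≤-Reasoning

  -- Both `X` and its complement are closed under the operations, so once a subsequence lies on one
  -- side, everything in its `FR` stays there.
  allClosed⇒Ramsey : ExcludedMiddle 0ℓ → (∀ Q s → ClosedUnder Q (interp 𝒜 s)) →
                     Ramsey 𝒜
  allClosed⇒Ramsey em closed b X with pigeonhole-ω em (X ∘ b)
  ... | g , inc , inj₁ in-X  =
    b ∘ g , subsequence inc b , inj₁ (FR-closed (closed X) in-X)
  ... | g , inc , inj₂ out-X =
    b ∘ g , subsequence inc b ,
    inj₂ λ (x∈FR , x∈X) → FR-closed (closed (∁ X)) out-X x∈FR x∈X

twoBinary : Language
twoBinary = record { Symbol = Bool ; arity = λ _ → 2 }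

projections : Bool → Algebra twoBinary
projections c = record
  { Carrier = ℕ
  -- Flipping `c` exchanges the two symbols; for `c = true`, `false` is the first projection and
  -- `true` the second.
  ; interp  = λ { s (x ∷ y ∷ []) → if c xor s then x else y }
  }

projections-closed : ∀ c Q s → ClosedUnder Q (interp (projections c) s)
projections-closed c Q s (qx ∷ qy ∷ []) with c xor s
... | true  = qx
... | false = qy

projections-Ramsey : ExcludedMiddle 0ℓ → ∀ c → Ramsey (projections c)
projections-Ramsey em c = allClosed⇒Ramsey em (projections-closed c)

module _ {I : Set} (c : I → Bool) {i₀ i₁ : I} (c-i₀ : c i₀ ≡ true) (c-i₁ : c i₁ ≡ false) where

  private
    𝒫 : Algebra twoBinary
    𝒫 = ∏ (projections ∘ c)

    diagonal : ℕ → Carrier 𝒫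
    diagonal n _ = n

    X : Pred (Carrier 𝒫) 0ℓ
    X z = z i₀ < z i₁

  coordinatewise-closed : (Q : Pred ℕ 0ℓ) (s : Bool) →
                          ClosedUnder (λ z → ∀ i → Q (z i)) (interp 𝒫 s)
  coordinatewise-closed Q s (qx ∷ qy ∷ []) i =
    projections-closed (c i) Q s (qx i ∷ qy i ∷ [])

  -- All coordinates of `diagonal n` equal `n`, so positions double as values. The index `p` may
  -- vary with `i`, since the factors project differently.
  diagonal-coordinates : ∀ {a} (r : Reduction 𝒫 a diagonal) j i →
                         ∃ λ p → a j i ≡ Reduction.pos r j p
  diagonal-coordinates r j =
    reduction-closed (coordinatewise-closed (λ x → ∃ λ p → x ≡ Reduction.pos r j p))
      r j (λ p _ → p , refl)

  diagonal-coordinates-< : ∀ {a} → Reduction 𝒫 a diagonal → ∀ i i′ → a 0 i < a 1 i′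
  diagonal-coordinates-< r i i′ =
    let p , a0i≡  = diagonal-coordinates r 0 i
        q , a1i′≡ = diagonal-coordinates r 1 i′
    in subst₂ _<_ (sym a0i≡) (sym a1i′≡) (Reduction.across r 0 1 ≤-refl p q)

  -- One factor of each kind is enough, which covers finite and infinite index sets at once.
  ∏projections-¬Ramsey : ¬ Ramsey 𝒫
  ∏projections-¬Ramsey ramsey with ramsey diagonal X
  ... | a , r , homogeneous = split homogeneous
    where
    f∈X : X (interp 𝒫 false (a 0 ∷ a 1 ∷ []))
    -- Coordinate `i₀` selects `a 0` and `i₁` selects `a 1`; for the symbol `true` it is the other
    -- way round.
    f∈X rewrite c-i₀ | c-i₁ = diagonal-coordinates-< r i₀ i₁

    g∉X : ¬ X (interp 𝒫 true (a 0 ∷ a 1 ∷ []))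
    g∉X rewrite c-i₀ | c-i₁ = <-asym (diagonal-coordinates-< r i₁ i₀)

    split : ¬ (FR 𝒫 a ⊆ X ⊎ FR 𝒫 a ⊥ X)
    split (inj₁ ⊆X) = g∉X (⊆X (initial∈FR (basic true) a))
    split (inj₂ ⊥X) = ⊥X (initial∈FR (basic false) a , f∈X)

isZero : ℕ → Bool
isZero zero    = true
isZero (suc _) = false

theorem4p3 : ExcludedMiddle 0ℓ →
    (Σ[ L ∈ Language ] Σ[ k ∈ ℕ ] Σ[ 𝒜 ∈ (Fin k → Algebra L) ]
    ((∀ i → Infinite (Carrier (𝒜 i)) × Ramsey (𝒜 i)) × ¬ Ramsey (∏ 𝒜)))
    ×
    (Σ[ L ∈ Language ] Σ[ I ∈ Set ] Infinite I × (Σ[ 𝒜 ∈ (I → Algebra L) ]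
    ((∀ i → Infinite (Carrier (𝒜 i)) × Ramsey (𝒜 i)) × ¬ Ramsey (∏ 𝒜))))
theorem4p3 em =
  ( twoBinary , 2 , projections ∘ isZero ∘ toℕ
  , (λ _ → ℕ-infinite , projections-Ramsey em _)
  , ∏projections-¬Ramsey (isZero ∘ toℕ) {Fin.zero} {Fin.suc Fin.zero} refl refl )
  ,
  ( twoBinary , ℕ , ℕ-infinite , projections ∘ isZero
  , (λ _ → ℕ-infinite , projections-Ramsey em _)
  , ∏projections-¬Ramsey isZero {0} {1} refl refl )
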